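{- There exists a constant $c$ such that for all integers $a\ge 2$ and $l\ge 1$, $$1+\frac{1}{al}\le R(a,l)\le 1+\frac{c}{al}.$$
   Context: For a nonempty finite string $x$ and a rational $r>1$ with $r|x|$ an integer, the fractional power $x^r$ is the prefix of length $r|x|$ of the infinite word $xxx\cdots$. For integers $a\ge 2$, $l\ge 1$, $R(a,l)$ is the infimum of the reals $r>1$ such that there exists an infinite sequence over an $a$-letter alphabet containing no factor (contiguous substring) of the form $x^{r'}$ with $|x|\ge l$ and $r'\ge r$. -}

module Defs where

open import Data.Nat using (ℕ; zero; suc; _+_; _≤_; _<_)
open import Data.Fin using (Fin)
open import Data.Integer using (+_)
open import Data.Product using (Σ; _×_)
open import Data.Rational using (ℚ; _/_; 0ℚ)
import Data.Rational as Q
open import Relation.Nullary using (¬_)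
open import Relation.Binary.PropositionalEquality using (_≡_)

ℕtoℚ : ℕ → ℚ
ℕtoℚ n = + n / 1

-- 1/n for n ≥ 1 (only ever used with n = a*l ≥ 2; value at 0 is irrelevant).
recip : ℕ → ℚ
recip zero    = 0ℚ
recip (suc n) = + 1 / suc n

-- w contains a factor x^{r'} with |x| = p ≥ l (p ≥ 1) and r' = n/p ≥ r:
-- the factor w[i .. i+n) has period p (so it equals x^{n/p} with x = w[i .. i+p)).
ContainsPower : {a : ℕ} → (ℕ → Fin a) → ℕ → ℚ → Set
ContainsPower w l r =
  Σ ℕ λ i → Σ ℕ λ p → Σ ℕ λ n →
    (l ≤ p) × (1 ≤ p) × (r Q.* ℕtoℚ p Q.≤ ℕtoℚ n) ×
    (∀ j → j + p < n → w (i + j) ≡ w (i + j + p))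

-- r (> 1) belongs to the set whose infimum is R(a,l): some infinite word over an
-- a-letter alphabet avoids all factors x^{r'} with |x| ≥ l and r' ≥ r.
Avoidable : ℕ → ℕ → ℚ → Set
Avoidable a l r = (Q.1ℚ Q.< r) × Σ (ℕ → Fin a) λ w → ¬ ContainsPower w l r

{-# OPTIONS --safe #-}
module Submission where

-- Lower bound: two of the letters at 0, l, …, al coincide, and their distance p lies
-- between l and al; this is a power of exponent (p + 1)/p.
--
-- Upper bound: give the n-th letter the two components ⌊n/l⌋ mod A, where A = ⌊a/2⌋, and
-- u(n), a binary word. The first component forces the distance of any repetition with
-- period p ≥ l up to p > al/6. The word u has the self-similarity u(4x) = u(x). Its values
-- u(4x+1) = 0 and u(4x+2) = 1 synchronise: long factors repeat only at distances divisible
-- by 4, so a long repetition can be scaled down by 4. The value u(4x+3) encodes ⌊x/16M⌋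
-- mod 16, with M of order al, one-hot at the position x mod 16, so repetitions whose
-- period has been scaled down to between 64M and 256M are short. Hence at distance p only
-- factors of length O(p/M) repeat.

open import Defs
import Data.Nat as ℕ
import Data.Nat.Properties as ℕ
open import Data.Product using (Σ; ∃; ∃₂; _×_; _,_; proj₁; proj₂)
open import Relation.Binary.PropositionalEquality
open import Relation.Nullary using (¬_; yes; no)

module Words where

  open import Data.Nat
  open import Data.Nat.Properties
  open import Data.Nat.DivMod
  open import Data.Nat.Divisibility using (divides-refl)
  open import Data.Nat.Induction using (<-wellFounded; Acc; acc)
  open import Data.Nat.Tactic.RingSolver using (solve-∀)
  open import Data.Empty using (⊥; ⊥-elim)
  open import Data.Fin using (Fin; toℕ; combine; inject≤)
  open import Data.Fin.Patterns using (0F; 1F)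
  open import Data.Fin.Properties
    using (pigeonhole; toℕ<n; toℕ-fromℕ<; combine-injective; inject≤-injective)

  private
    variable
      X : Set

  -- Division with remainder.

  [r+x*d]/d≡x : ∀ {r} x d .{{_ : NonZero d}} → r < d → (r + x * d) / d ≡ x
  [r+x*d]/d≡x {r} x d r<d =
    trans (+-distrib-/-∣ʳ r (divides-refl x)) (cong₂ _+_ (m<n⇒m/n≡0 r<d) (m*n/n≡m x d))

  [r+x*d]%d≡r : ∀ {r} x d .{{_ : NonZero d}} → r < d → (r + x * d) % d ≡ r
  [r+x*d]%d≡r {r} x d r<d = trans ([m+kn]%n≡m%n r x d) (m<n⇒m%n≡m r<d)

  %-≡⇒gap : ∀ {m n} d .{{_ : NonZero d}} → m < n → m % d ≡ n % d → d + m ≤ n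
  %-≡⇒gap {m} {n} d m<n m≡n = begin
    d + m                    ≡⟨ cong (d +_) (m≡m%n+[m/n]*n m d) ⟩
    d + (m % d + m / d * d)  ≡⟨ shift d (m % d) (m / d * d) ⟩
    m % d + suc (m / d) * d  ≤⟨ +-monoʳ-≤ (m % d) (*-monoˡ-≤ d q<q′) ⟩
    m % d + n / d * d        ≡⟨ cong (_+ n / d * d) m≡n ⟩
    n % d + n / d * d        ≡⟨ m≡m%n+[m/n]*n n d ⟨
    n                        ∎
    where
    open ≤-Reasoning
    shift : ∀ d r x → d + (r + x) ≡ r + (d + x)
    shift = solve-∀
    q<q′ : m / d < n / d
    q<q′ = ≰⇒> λ q′≤q → <⇒≱ m<n (begin
      n                  ≡⟨ m≡m%n+[m/n]*n n d ⟩
      n % d + n / d * d  ≤⟨ +-monoʳ-≤ (n % d) (*-monoˡ-≤ d q′≤q) ⟩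
      n % d + m / d * d  ≡⟨ cong (_+ m / d * d) m≡n ⟨
      m % d + m / d * d  ≡⟨ m≡m%n+[m/n]*n m d ⟨
      m                  ∎)

  n<[1+n/d]*d : ∀ n d .{{_ : NonZero d}} → n < suc (n / d) * d
  n<[1+n/d]*d n d = begin-strict
    n                  ≡⟨ m≡m%n+[m/n]*n n d ⟩
    n % d + n / d * d  <⟨ +-monoˡ-< (n / d * d) (m%n<n n d) ⟩
    suc (n / d) * d    ∎
    where open ≤-Reasoning

  [m+k*d]/d≡m/d+k : ∀ m k d .{{_ : NonZero d}} → (m + k * d) / d ≡ m / d + k
  [m+k*d]/d≡m/d+k m k d =
    trans (+-distrib-/-∣ʳ m (divides-refl k)) (cong (m / d +_) (m*n/n≡m k d))

  abstract
    next-multiple : ∀ i d .{{_ : NonZero d}} → ∃ λ e → i ≤ e * d × e * d < i + d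
    -- The divisor is `suc d`, so the witness is the quotient `i / suc d` rounded up.
    next-multiple i (suc d) = (i + d) / suc d ,
      +-cancelʳ-≤ d _ _ (≤-pred (≤-trans (n<[1+n/d]*d (i + d) (suc d))
        (≤-reflexive (shift ((i + d) / suc d * suc d) d)))) ,
      ≤-trans (s≤s (m/n*n≤m (i + d) (suc d))) (≤-reflexive (sym (+-suc i d)))
      where
      shift : ∀ x d → suc d + x ≡ suc (x + d)
      shift = solve-∀

  -- Repetitions as agreement of a word with its translate.

  -- Equivalently, the factor of length `p + q` at `i` has period `p`. Thus `q` is the excess over
  -- one period, and the exponent is `1 + q/p`.
  Agrees : (ℕ → X) → ℕ → ℕ → ℕ → Set
  Agrees u i p q = ∀ n → i ≤ n → n < i + q → u n ≡ u (n + p)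

  Agrees-shrink : ∀ {u : ℕ → X} {i p q q′} → q′ ≤ q → Agrees u i p q → Agrees u i p q′
  Agrees-shrink {i = i} q′≤q ag n i≤n n< = ag n i≤n (<-≤-trans n< (+-monoʳ-≤ i q′≤q))

  -- Only the multiples of 4 in the window are read, where `u` copies itself; among `q` consecutive
  -- positions there are at least `q / 4` of them.
  Agrees-*4 : ∀ {u : ℕ → X} → (∀ x → u (x * 4) ≡ u x) →
              ∀ {i p q} → Agrees u i (p * 4) q → ∃ λ i′ → Agrees u i′ p (q / 4)
  Agrees-*4 {u = u} u-*4 {i} {p} {q} ag with next-multiple i 4
  ... | e , i≤e*4 , e*4<i+4 = e , λ n e≤n n< → let open ≡-Reasoning in begin
    u n                ≡⟨ u-*4 n ⟨
    u (n * 4)          ≡⟨ ag (n * 4) (≤-trans i≤e*4 (*-monoˡ-≤ 4 e≤n)) (upper n n<) ⟩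
    u (n * 4 + p * 4)  ≡⟨ cong u (*-distribʳ-+ 4 n p) ⟨
    u ((n + p) * 4)    ≡⟨ u-*4 (n + p) ⟩
    u (n + p)          ∎
    where
    shift : ∀ i x → i + 4 + x ≡ 4 + (i + x)
    shift = solve-∀
    upper : ∀ n → n < e + q / 4 → n * 4 < i + q
    upper n n< = +-cancelˡ-< 4 _ _ (let open ≤-Reasoning in begin-strict
      suc n * 4           ≤⟨ *-monoˡ-≤ 4 n< ⟩
      (e + q / 4) * 4     ≡⟨ *-distribʳ-+ 4 e (q / 4) ⟩
      e * 4 + q / 4 * 4   <⟨ +-mono-<-≤ e*4<i+4 (m/n*n≤m q 4) ⟩
      i + 4 + q           ≡⟨ shift i q ⟩
      4 + (i + q)         ∎)

  -- The self-similar binary word.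

  module Toeplitz (M : ℕ) .{{_ : NonZero M}} where

    mark : ℕ → ℕ → Fin 2
    mark r s with r ≟ s
    ... | yes _ = 1F
    ... | no  _ = 0F

    mark-refl : ∀ r → mark r r ≡ 1F
    mark-refl r with r ≟ r
    ... | yes _   = refl
    ... | no  r≢r = ⊥-elim (r≢r refl)

    mark-1F : ∀ r s → mark r s ≡ 1F → r ≡ s
    mark-1F r s eq with r ≟ s
    ... | yes r≡s = r≡s

    datum : ℕ → Fin 2
    datum x = mark (x / 16 / M % 16) (x % 16)

    -- A Toeplitz filling: residues 1, 2, 3 mod 4 get prescribed letters, and the holes at residue 0
    -- receive `b`, the word's own letter at `x`. The last clause serves residue 3.
    digit : ℕ → ℕ → Fin 2 → Fin 2
    digit 0 x b = b
    digit 1 x b = 0F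
    digit 2 x b = 1F
    digit _ x b = datum x

    -- Recursion on fuel; any amount f ≥ n gives the same letter at n.
    letterWithin : ℕ → ℕ → Fin 2
    letterWithin zero    n = 0F
    letterWithin (suc f) n = digit (n % 4) (n / 4) (letterWithin f (n / 4))

    toeplitz : ℕ → Fin 2
    toeplitz n = letterWithin n n

    n/4≤pred : ∀ {n f} → n ≤ suc f → n / 4 ≤ f
    n/4≤pred {zero}  _         = z≤n
    n/4≤pred {suc n} (s≤s n≤f) = ≤-trans (≤-pred (m/n<m (suc n) 4 (s≤s (s≤s z≤n)))) n≤f

    letterWithin-0 : ∀ f → letterWithin f 0 ≡ 0F
    letterWithin-0 zero    = refl
    letterWithin-0 (suc f) = letterWithin-0 f

    letterWithin-fuel : ∀ {f g} n → n ≤ f → n ≤ g → letterWithin f n ≡ letterWithin g n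
    letterWithin-fuel {zero}  {g}     zero    _   _   = sym (letterWithin-0 g)
    letterWithin-fuel {suc f} {zero}  zero    _   _   = letterWithin-0 f
    letterWithin-fuel {suc f} {suc g} n       n≤f n≤g =
      cong (digit (n % 4) (n / 4))
        (letterWithin-fuel (n / 4) (n/4≤pred n≤f) (n/4≤pred n≤g))

    toeplitz-step : ∀ r x → r < 4 → toeplitz (r + x * 4) ≡ digit r x (toeplitz x)
    toeplitz-step r x r<4 = begin
      letterWithin n n
        -- One extra unit of fuel exposes the recursive clause.
        ≡⟨ letterWithin-fuel n ≤-refl (n≤1+n n) ⟩
      digit (n % 4) (n / 4) (letterWithin n (n / 4))
        ≡⟨ cong₂ (λ s y → digit s y (letterWithin n y)) ([r+x*d]%d≡r x 4 r<4) ([r+x*d]/d≡x x 4 r<4) ⟩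
      digit r x (letterWithin n x)
        ≡⟨ cong (digit r x) (letterWithin-fuel x x≤n ≤-refl) ⟩
      digit r x (toeplitz x) ∎
      where
      open ≡-Reasoning
      n = r + x * 4
      x≤n : x ≤ n
      x≤n = ≤-trans (m≤m*n x 4) (m≤n+m (x * 4) r)

    toeplitz-0 : ∀ x → toeplitz (x * 4) ≡ toeplitz x
    toeplitz-0 x = toeplitz-step 0 x (s≤s z≤n)

    toeplitz-1 : ∀ {n} x → n ≡ 1 + x * 4 → toeplitz n ≡ 0F
    toeplitz-1 x refl = toeplitz-step 1 x (s≤s (s≤s z≤n))

    toeplitz-2 : ∀ {n} x → n ≡ 2 + x * 4 → toeplitz n ≡ 1F
    toeplitz-2 x refl = toeplitz-step 2 x (s≤s (s≤s (s≤s z≤n)))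

    toeplitz-3 : ∀ {n} x → n ≡ 3 + x * 4 → toeplitz n ≡ datum x
    toeplitz-3 x refl = toeplitz-step 3 x ≤-refl

    0F≢1F : _≢_ {A = Fin 2} 0F 1F
    0F≢1F ()

    datum-block : ∀ e r → r < 16 → datum (r + e * 16) ≡ mark (e / M % 16) r
    datum-block e r r<16 =
      cong₂ (λ k s → mark (k / M % 16) s) ([r+x*d]/d≡x e 16 r<16) ([r+x*d]%d≡r e 16 r<16)

    -- Any other residue of `p` mod 4 carries a position with known letter to one with the opposite
    -- letter. Of the 32 positions, 16 pay for rounding `i` up to a multiple of 16, and the probes
    -- lie in the rest.
    4∣shift : ∀ {i p} → Agrees toeplitz i p 32 → ∃ λ p′ → p ≡ p′ * 4
    4∣shift {i} {p} ag with next-multiple i 16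
    ... | e , i≤e*16 , e*16<i+16 =
      p / 4 , residue (p % 4) (p / 4) (m≡m%n+[m/n]*n p 4) (m%n<n p 4)
      where
      probe : ∀ r → r ≤ 16 → toeplitz (r + e * 16) ≡ toeplitz (r + e * 16 + p)
      probe r r≤16 = ag (r + e * 16) (≤-trans i≤e*16 (m≤n+m (e * 16) r))
        (<-≤-trans (+-mono-≤-< r≤16 e*16<i+16) (≤-reflexive (shift i)))
        where
        shift : ∀ i → 16 + (i + 16) ≡ i + 32
        shift = solve-∀

      residue : ∀ r x → p ≡ r + x * 4 → r < 4 → p ≡ x * 4
      residue 0 x p≡ _ = p≡
      residue 1 x refl _ = ⊥-elim (0F≢1F (trans (sym (toeplitz-1 (e * 4) (eq₁ e)))
        (trans (probe 1 (m≤m+n 1 15)) (toeplitz-2 (e * 4 + x) (eq₂ e x)))))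
        where
        eq₁ : ∀ e → 1 + e * 16 ≡ 1 + e * 4 * 4
        eq₁ = solve-∀
        eq₂ : ∀ e x → 1 + e * 16 + (1 + x * 4) ≡ 2 + (e * 4 + x) * 4
        eq₂ = solve-∀
      -- Residues 1 and 2 move to 3 and 0, where no constant is prescribed. Instead, `4 + e * 16` is
      -- 4 times a number of residue 1, so its letter is 0, and it moves to residue 2.
      residue 2 x refl _ = ⊥-elim (0F≢1F (trans (sym quarter)
        (trans (probe 4 (m≤m+n 4 12)) (toeplitz-2 (1 + e * 4 + x) (eq₂ e x)))))
        where
        eq₁ : ∀ e → 4 + e * 16 ≡ (1 + e * 4) * 4
        eq₁ = solve-∀
        eq₂ : ∀ e x → 4 + e * 16 + (2 + x * 4) ≡ 2 + (1 + e * 4 + x) * 4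
        eq₂ = solve-∀
        quarter : toeplitz (4 + e * 16) ≡ 0F
        quarter = trans (cong toeplitz (eq₁ e)) (trans (toeplitz-0 (1 + e * 4)) (toeplitz-1 e refl))
      residue 3 x refl _ = ⊥-elim (0F≢1F (trans (sym (toeplitz-1 (1 + e * 4 + x) (eq₂ e x)))
        (trans (sym (probe 2 (m≤m+n 2 14))) (toeplitz-2 (e * 4) (eq₁ e)))))
        where
        eq₁ : ∀ e → 2 + e * 16 ≡ 2 + e * 4 * 4
        eq₁ = solve-∀
        eq₂ : ∀ e x → 2 + e * 16 + (3 + x * 4) ≡ 1 + (1 + e * 4 + x) * 4
        eq₂ = solve-∀
      residue (suc (suc (suc (suc _)))) _ _ (s≤s (s≤s (s≤s (s≤s ()))))

    -- The window contains an aligned block of 64 letters, number `e`, which holds 16 data and moves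
    -- onto block `e + p`. The only marked datum of block `e` must stay marked, so `e / M` and
    -- `(e + p) / M` agree mod 16; yet they differ by at least 1 and at most 4.
    datum-separates : ∀ {i p} → M ≤ p → p < 4 * M → Agrees toeplitz i (p * 64) 128 → ⊥
    datum-separates {i} {p} M≤p p<4M ag with next-multiple i 64
    ... | e , i≤e*64 , e*64<i+64 =
      <⇒≱ (m≤m+n 5 11) (+-cancelʳ-≤ (e / M) 16 4 (let open ≤-Reasoning in begin
      16 + e / M       ≤⟨ %-≡⇒gap 16 k<k′ same-residue ⟩
      (e + p) / M      ≤⟨ /-monoˡ-≤ M (+-monoʳ-≤ e (<⇒≤ p<4M)) ⟩
      (e + 4 * M) / M  ≡⟨ [m+k*d]/d≡m/d+k e 4 M ⟩
      e / M + 4        ≡⟨ +-comm (e / M) 4 ⟩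
      4 + e / M        ∎))
      where
      r = e / M % 16
      r<16 : r < 16
      r<16 = m%n<n (e / M) 16
      n = 3 + (r + e * 16) * 4

      k<k′ : e / M < (e + p) / M
      k<k′ = let open ≤-Reasoning in begin
        1 + e / M        ≡⟨ +-comm 1 (e / M) ⟩
        e / M + 1        ≡⟨ [m+k*d]/d≡m/d+k e 1 M ⟨
        (e + 1 * M) / M  ≤⟨ /-monoˡ-≤ M (+-monoʳ-≤ e (≤-trans (≤-reflexive (*-identityˡ M)) M≤p)) ⟩
        (e + p) / M      ∎

      n≡ : ∀ r e → 3 + (r + e * 16) * 4 ≡ (3 + r * 4) + e * 64
      n≡ = solve-∀
      n+p≡ : ∀ r e p → 3 + (r + e * 16) * 4 + p * 64 ≡ 3 + (r + (e + p) * 16) * 4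
      n+p≡ = solve-∀
      lower : i ≤ n
      lower = let open ≤-Reasoning in begin
        i                       ≤⟨ i≤e*64 ⟩
        e * 64                  ≤⟨ m≤n+m (e * 64) (3 + r * 4) ⟩
        (3 + r * 4) + e * 64    ≡⟨ n≡ r e ⟨
        n                       ∎
      shift : ∀ i → 64 + (i + 64) ≡ i + 128
      shift = solve-∀
      upper : n < i + 128
      upper = let open ≤-Reasoning in begin-strict
        n                       ≡⟨ n≡ r e ⟩
        (3 + r * 4) + e * 64    <⟨ +-mono-<-≤ (*-monoˡ-≤ 4 r<16) (<⇒≤ e*64<i+64) ⟩
        64 + (i + 64)           ≡⟨ shift i ⟩
        i + 128                 ∎

      same-residue : e / M % 16 ≡ (e + p) / M % 16
      same-residue = sym (mark-1F ((e + p) / M % 16) r (let open ≡-Reasoning in begin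
        mark ((e + p) / M % 16) r          ≡⟨ datum-block (e + p) r r<16 ⟨
        datum (r + (e + p) * 16)           ≡⟨ toeplitz-3 (r + (e + p) * 16) (n+p≡ r e p) ⟨
        toeplitz (n + p * 64)              ≡⟨ ag n lower upper ⟨
        toeplitz n                         ≡⟨ toeplitz-3 (r + e * 16) refl ⟩
        datum (r + e * 16)                 ≡⟨ datum-block e r r<16 ⟩
        mark r r                           ≡⟨ mark-refl r ⟩
        1F                                 ∎))

    -- The hypothesis says M ≤ ⌈p/64⌉: besides p ≥ 64M it admits M = 1 with any p ≥ 1, which
    -- covers small al. The bound is on suc q since suc q ≤ 4 * suc (q / 4) loses nothing
    -- in the descent.
    agreement-short′ : ∀ p → Acc _<_ p → 1 ≤ p → 64 * M ≤ p + 63 →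
                       ∀ {i q} → Agrees toeplitz i p q → suc q * M ≤ 512 * p
    agreement-short′ p (acc rec) 1≤p 64M≤p+63 {i} {q} ag with q <? 512
    -- For short windows it suffices that `M ≤ p`, which follows since 63 is at most `63 * p`.
    ... | yes q<512 = begin
      suc q * M       ≤⟨ *-monoˡ-≤ M q<512 ⟩
      512 * M         ≡⟨ *-assoc 8 64 M ⟩
      8 * (64 * M)    ≤⟨ *-monoʳ-≤ 8 64M≤p+63 ⟩
      8 * (p + 63)    ≤⟨ *-monoʳ-≤ 8 (+-monoʳ-≤ p (*-monoʳ-≤ 63 1≤p)) ⟩
      8 * (64 * p)    ≡⟨ *-assoc 8 64 p ⟨
      512 * p         ∎
      where open ≤-Reasoning
    -- Two scalings leave windows of at least 128 and then 32 letters, so `4∣shift` applies three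
    -- times and 64 divides the distance.
    ... | no q≮512 with 4∣shift (Agrees-shrink (≤-trans (m≤m+n 32 480) (≮⇒≥ q≮512)) ag)
    ... | p₁ , refl with Agrees-*4 toeplitz-0 {p = p₁} ag
    ... | i₁ , ag₁ with 4∣shift {p = p₁}
                          (Agrees-shrink (≤-trans (m≤m+n 32 96) (/-monoˡ-≤ 4 (≮⇒≥ q≮512))) ag₁)
    ... | p₂ , refl with Agrees-*4 toeplitz-0 {p = p₂} ag₁
    ... | i₂ , ag₂ with 4∣shift {p = p₂}
                          (Agrees-shrink (/-monoˡ-≤ 4 (/-monoˡ-≤ 4 (≮⇒≥ q≮512))) ag₂)
    ... | p′ , refl = descend
      where
      open ≤-Reasoning
      p≡ : ∀ p → p * 4 * 4 * 4 ≡ p * 64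
      p≡ = solve-∀

      M≤p′ : M ≤ p′
      M≤p′ = ≤-pred (*-cancelˡ-< 64 M (suc p′) (begin-strict
        64 * M                 ≤⟨ 64M≤p+63 ⟩
        p′ * 4 * 4 * 4 + 63    <⟨ +-monoʳ-< (p′ * 4 * 4 * 4) (n<1+n 63) ⟩
        p′ * 4 * 4 * 4 + 64    ≡⟨ eq p′ ⟩
        64 * suc p′            ∎))
        where
        eq : ∀ p → p * 4 * 4 * 4 + 64 ≡ 64 * suc p
        eq = solve-∀

      1≤p′ : 1 ≤ p′
      1≤p′ = ≤-trans (>-nonZero⁻¹ M) M≤p′

      descend : suc q * M ≤ 512 * (p′ * 4 * 4 * 4)
      descend with p′ <? 4 * M
      ... | yes p′<4M = ⊥-elim (datum-separates M≤p′ p′<4M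
        (subst (λ p → Agrees toeplitz i p 128) (p≡ p′)
          (Agrees-shrink (≤-trans (m≤m+n 128 384) (≮⇒≥ q≮512)) ag)))
      -- The induction removes a single factor 4: a quarter of the distance is `16 * p′`, still at
      -- least `64 * M`.
      ... | no p′≮4M = begin
        suc q * M                       ≤⟨ *-monoˡ-≤ M (n<[1+n/d]*d q 4) ⟩
        suc (q / 4) * 4 * M             ≡⟨ swap (suc (q / 4)) M ⟩
        4 * (suc (q / 4) * M)           ≤⟨ *-monoʳ-≤ 4 (agreement-short′ (p′ * 4 * 4)
                                             (rec (m<m*n (p′ * 4 * 4) 4 ⦃ >-nonZero 1≤p₁ ⦄ (m≤m+n 2 2)))
                                             1≤p₁ 64M≤p₁+63 ag₁) ⟩
        4 * (512 * (p′ * 4 * 4))        ≡⟨ swap′ (p′ * 4 * 4) ⟩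
        512 * (p′ * 4 * 4 * 4)          ∎
        where
        swap : ∀ x y → x * 4 * y ≡ 4 * (x * y)
        swap = solve-∀
        swap′ : ∀ x → 4 * (512 * x) ≡ 512 * (x * 4)
        swap′ = solve-∀
        1≤p₁ : 1 ≤ p′ * 4 * 4
        1≤p₁ = *-mono-≤ (*-mono-≤ 1≤p′ (m≤m+n 1 3)) (m≤m+n 1 3)
        eq : ∀ p → 16 * p ≡ p * 4 * 4
        eq = solve-∀
        64M≤p₁+63 : 64 * M ≤ p′ * 4 * 4 + 63
        64M≤p₁+63 = begin
          64 * M             ≡⟨ *-assoc 16 4 M ⟩
          16 * (4 * M)       ≤⟨ *-monoʳ-≤ 16 (≮⇒≥ p′≮4M) ⟩
          16 * p′            ≡⟨ eq p′ ⟩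
          p′ * 4 * 4         ≤⟨ m≤m+n (p′ * 4 * 4) 63 ⟩
          p′ * 4 * 4 + 63    ∎

    agreement-short : ∀ {p i q} → 1 ≤ p → 64 * M ≤ p + 63 →
                      Agrees toeplitz i p q → suc q * M ≤ 512 * p
    agreement-short {p} 1≤p 64M≤p+63 ag = agreement-short′ p (<-wellFounded p) 1≤p 64M≤p+63 ag

  -- The word over `a` letters and its repetitions.

  -- Moving by `p ≥ l` changes the zone number `n / l`, and equal residues force it up by at least
  -- `A`. Hence `p` exceeds `(A - 1) * l`, and one more `l` costs at most `p`.
  zones⇒far : ∀ A n {l p} .{{_ : NonZero A}} .{{_ : NonZero l}} → l ≤ p →
              (n / l) % A ≡ ((n + p) / l) % A → A * l < 2 * p
  zones⇒far A n {l} {p} l≤p same = +-cancelʳ-< (n / l * l) _ _ (begin-strict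
    A * l + n / l * l        ≡⟨ *-distribʳ-+ l A (n / l) ⟨
    (A + n / l) * l          ≤⟨ *-monoˡ-≤ l (%-≡⇒gap A next-zone same) ⟩
    (n + p) / l * l          ≤⟨ m/n*n≤m (n + p) l ⟩
    n + p                    <⟨ +-mono-<-≤ (n<[1+n/d]*d n l) (≤-refl {p}) ⟩
    l + n / l * l + p        ≤⟨ +-monoˡ-≤ p (+-monoˡ-≤ (n / l * l) l≤p) ⟩
    p + n / l * l + p        ≡⟨ shift p (n / l * l) ⟩
    2 * p + n / l * l        ∎)
    where
    open ≤-Reasoning
    shift : ∀ p x → p + x + p ≡ 2 * p + x
    shift = solve-∀
    next-zone : n / l < (n + p) / l
    next-zone = begin
      1 + n / l        ≡⟨ +-comm 1 (n / l) ⟩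
      n / l + 1        ≡⟨ [m+k*d]/d≡m/d+k n 1 l ⟨
      (n + 1 * l) / l  ≤⟨ /-monoˡ-≤ l (+-monoʳ-≤ n (≤-trans (≤-reflexive (*-identityˡ l)) l≤p)) ⟩
      (n + p) / l      ∎

  a≤3[a/2] : ∀ {a} → 2 ≤ a → a ≤ 3 * (a / 2)
  a≤3[a/2] {a} 2≤a = ≤-pred (begin
    suc a                  ≤⟨ n<[1+n/d]*d a 2 ⟩
    suc (a / 2) * 2        ≡⟨ shift (a / 2) ⟩
    suc (1 + 2 * (a / 2))  ≤⟨ s≤s (+-monoˡ-≤ (2 * (a / 2)) (/-monoˡ-≤ 2 2≤a)) ⟩
    suc (3 * (a / 2))      ∎)
    where
    open ≤-Reasoning
    shift : ∀ x → suc x * 2 ≡ suc (1 + 2 * x)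
    shift = solve-∀

  module Word (a l : ℕ) .{{_ : NonZero l}} (2≤a : 2 ≤ a) where

    A = a / 2

    instance
      A≢0 : NonZero A
      A≢0 = >-nonZero (/-monoˡ-≤ 2 2≤a)

    -- Here `384 = 6 * 64`: the zones give `a * l < 6 * p`, hence `64 * (a * l / 384) < p`. The
    -- successor keeps `M` positive and ensures `a * l < M * 384`.
    M = suc (a * l / 384)

    open Toeplitz M

    word : ℕ → Fin a
    word n = inject≤ (combine ((n / l) mod A) (toeplitz n)) (m/n*n≤m a 2)

    word-≡ : ∀ {m n} → word m ≡ word n →
                     (m / l) % A ≡ (n / l) % A × toeplitz m ≡ toeplitz n
    word-≡ {m} {n} eq with combine-injective _ _ _ _ (inject≤-injective _ _ _ _ eq)
    ... | zone , letter = trans (sym (toℕ-fromℕ< (m%n<n (m / l) A)))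
      (trans (cong toℕ zone) (toℕ-fromℕ< (m%n<n (n / l) A))) , letter

    -- The zones, compared at position `i` alone, make `p` large enough for `agreement-short`;
    -- returning from `M` to `a * l` costs the factor 384.
    repetition-short : ∀ {i p q} → l ≤ p → 1 ≤ p → 1 ≤ q →
                       Agrees word i p q → a * l * q ≤ 384 * (512 * p)
    repetition-short {i} {p} {q} l≤p 1≤p 1≤q ag = begin
      a * l * q              ≤⟨ *-monoˡ-≤ q (<⇒≤ (n<[1+n/d]*d (a * l) 384)) ⟩
      M * 384 * q            ≡⟨ swap M q ⟩
      384 * (q * M)          ≤⟨ *-monoʳ-≤ 384 (*-monoˡ-≤ M (n≤1+n q)) ⟩
      384 * (suc q * M)      ≤⟨ *-monoʳ-≤ 384 (agreement-short 1≤p 64M≤p+63 agᵗ) ⟩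
      384 * (512 * p)        ∎
      where
      open ≤-Reasoning
      swap : ∀ x y → x * 384 * y ≡ 384 * (y * x)
      swap = solve-∀
      agᵗ : Agrees toeplitz i p q
      agᵗ n i≤n n< = proj₂ (word-≡ (ag n i≤n n<))
      al<6p : a * l < 6 * p
      al<6p = begin-strict
        a * l            ≤⟨ *-monoˡ-≤ l (a≤3[a/2] 2≤a) ⟩
        3 * A * l        ≡⟨ *-assoc 3 A l ⟩
        3 * (A * l)      <⟨ *-monoʳ-< 3 (zones⇒far A i l≤p (proj₁ (word-≡
                              (ag i ≤-refl (m<m+n i 1≤q))))) ⟩
        3 * (2 * p)      ≡⟨ *-assoc 3 2 p ⟨
        6 * p            ∎
      x = a * l / 384
      64x<p : 64 * x < p
      64x<p = *-cancelˡ-< 6 (64 * x) p (begin-strict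
        6 * (64 * x)     ≡⟨ *-assoc 6 64 x ⟨
        384 * x          ≡⟨ *-comm 384 x ⟩
        x * 384          ≤⟨ m/n*n≤m (a * l) 384 ⟩
        a * l            <⟨ al<6p ⟩
        6 * p            ∎)
      64M≤p+63 : 64 * M ≤ p + 63
      64M≤p+63 = begin
        64 * M           ≡⟨ eq x ⟩
        suc (64 * x) + 63 ≤⟨ +-monoˡ-≤ 63 64x<p ⟩
        p + 63           ∎
        where
        eq : ∀ x → 64 * suc x ≡ suc (64 * x) + 63
        eq = solve-∀

  -- A repeated letter by pigeonhole.

  repeated-letter : ∀ {a l} (w : ℕ → Fin a) →
                    ∃₂ λ i p → l ≤ p × p ≤ a * l × w i ≡ w (i + p)
  repeated-letter {a} {l} w with pigeonhole (n<1+n a) (λ k → w (toℕ k * l))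
  ... | x , y , x<y , wx≡wy = toℕ x * l , d * l ,
    ≤-trans (≤-reflexive (sym (*-identityˡ l))) (*-monoˡ-≤ l (m<n⇒0<n∸m x<y)) ,
    *-monoˡ-≤ l (≤-trans (m∸n≤m (toℕ y) (toℕ x)) (≤-pred (toℕ<n y))) ,
    trans wx≡wy (cong w (trans (cong (_* l) (sym (m+[n∸m]≡n (<⇒≤ x<y)))) (*-distribʳ-+ l (toℕ x) d)))
    where d = toℕ y ∸ toℕ x

open import Data.Nat using (ℕ; suc; _≤_; _*_)
open import Data.Rational using (ℚ; 1ℚ; _+_; _<_; toℚᵘ; NonNegative; Positive)
import Data.Rational as Q
import Data.Rational.Properties as ℚ
import Data.Integer as ℤ
import Data.Integer.Properties as ℤ
open import Data.Rational.Unnormalised as ℚᵘ using (mkℚᵘ; _≃_; *≡*; *≤*)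
import Data.Rational.Unnormalised.Properties as ℚᵘ
open import Data.Rational.Solver using (module +-*-Solver)

-- Natural numbers inside the rationals.

ℕtoℚ-nonNegative : ∀ n → NonNegative (ℕtoℚ n)
ℕtoℚ-nonNegative n = ℚ.normalize-nonNeg n 1

ℕtoℚ-positive : ∀ n → Positive (ℕtoℚ (suc n))
ℕtoℚ-positive n = ℚ.normalize-pos (suc n) 1

-- Rationals are kept in lowest terms, so the laws of the embedding are checked on bare fractions;
-- the field 0 of `mkℚᵘ` encodes denominator 1.
toℚᵘ-ℕtoℚ : ∀ n → toℚᵘ (ℕtoℚ n) ≃ mkℚᵘ (ℤ.+ n) 0
toℚᵘ-ℕtoℚ n = ℚ.toℚᵘ-fromℚᵘ (mkℚᵘ (ℤ.+ n) 0)

ℕtoℚ-+ : ∀ m n → ℕtoℚ (m ℕ.+ n) ≡ ℕtoℚ m + ℕtoℚ n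
ℕtoℚ-+ m n = ℚ.toℚᵘ-injective (begin
  toℚᵘ (ℕtoℚ (m ℕ.+ n))                   ≈⟨ toℚᵘ-ℕtoℚ (m ℕ.+ n) ⟩
  mkℚᵘ (ℤ.+ (m ℕ.+ n)) 0                  ≈⟨ *≡* (cong (ℤ._* ℤ.1ℤ)
    (trans (ℤ.pos-+ m n) (sym (cong₂ ℤ._+_ (ℤ.*-identityʳ (ℤ.+ m)) (ℤ.*-identityʳ (ℤ.+ n)))))) ⟩
  mkℚᵘ (ℤ.+ m) 0 ℚᵘ.+ mkℚᵘ (ℤ.+ n) 0      ≈⟨ ℚᵘ.+-cong (toℚᵘ-ℕtoℚ m) (toℚᵘ-ℕtoℚ n) ⟨
  toℚᵘ (ℕtoℚ m) ℚᵘ.+ toℚᵘ (ℕtoℚ n)        ≈⟨ ℚ.toℚᵘ-homo-+ (ℕtoℚ m) (ℕtoℚ n) ⟨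
  toℚᵘ (ℕtoℚ m + ℕtoℚ n)                  ∎)
  where open ℚᵘ.≃-Reasoning

ℕtoℚ-* : ∀ m n → ℕtoℚ (m * n) ≡ ℕtoℚ m Q.* ℕtoℚ n
ℕtoℚ-* m n = ℚ.toℚᵘ-injective (begin
  toℚᵘ (ℕtoℚ (m * n))                     ≈⟨ toℚᵘ-ℕtoℚ (m * n) ⟩
  mkℚᵘ (ℤ.+ (m * n)) 0                    ≈⟨ *≡* (cong (ℤ._* ℤ.1ℤ) (ℤ.pos-* m n)) ⟩
  mkℚᵘ (ℤ.+ m) 0 ℚᵘ.* mkℚᵘ (ℤ.+ n) 0      ≈⟨ ℚᵘ.*-cong (toℚᵘ-ℕtoℚ m) (toℚᵘ-ℕtoℚ n) ⟨
  toℚᵘ (ℕtoℚ m) ℚᵘ.* toℚᵘ (ℕtoℚ n)        ≈⟨ ℚ.toℚᵘ-homo-* (ℕtoℚ m) (ℕtoℚ n) ⟨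
  toℚᵘ (ℕtoℚ m Q.* ℕtoℚ n)                ∎)
  where open ℚᵘ.≃-Reasoning

recip-inverse : ∀ n → recip (suc n) Q.* ℕtoℚ (suc n) ≡ 1ℚ
recip-inverse n = ℚ.toℚᵘ-injective (begin
  toℚᵘ (recip (suc n) Q.* ℕtoℚ (suc n))            ≈⟨ ℚ.toℚᵘ-homo-* (recip (suc n)) (ℕtoℚ (suc n)) ⟩
  toℚᵘ (recip (suc n)) ℚᵘ.* toℚᵘ (ℕtoℚ (suc n))    ≈⟨ ℚᵘ.*-cong
    (ℚ.toℚᵘ-fromℚᵘ (mkℚᵘ ℤ.1ℤ n)) (toℚᵘ-ℕtoℚ (suc n)) ⟩
  mkℚᵘ ℤ.1ℤ n ℚᵘ.* mkℚᵘ (ℤ.+ suc n) 0              ≈⟨ ℚᵘ.*-inverseˡ (mkℚᵘ (ℤ.+ suc n) 0) ⟩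
  toℚᵘ 1ℚ                                          ∎)
  where open ℚᵘ.≃-Reasoning

ℕtoℚ-mono-≤ : ∀ {m n} → m ≤ n → ℕtoℚ m Q.≤ ℕtoℚ n
ℕtoℚ-mono-≤ {m} {n} m≤n = ℚ.toℚᵘ-cancel-≤ (begin
  toℚᵘ (ℕtoℚ m)     ≃⟨ toℚᵘ-ℕtoℚ m ⟩
  mkℚᵘ (ℤ.+ m) 0    ≤⟨ *≤* (ℤ.*-monoʳ-≤-nonNeg ℤ.1ℤ (ℤ.+≤+ m≤n)) ⟩
  mkℚᵘ (ℤ.+ n) 0    ≃⟨ toℚᵘ-ℕtoℚ n ⟨
  toℚᵘ (ℕtoℚ n)     ∎)
  where open ℚᵘ.≤-Reasoning

ℕtoℚ-cancel-< : ∀ {m n} → ℕtoℚ m < ℕtoℚ n → m ℕ.< n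
ℕtoℚ-cancel-< m<n = ℕ.≰⇒> λ n≤m → ℚ.<-irrefl refl (ℚ.<-≤-trans m<n (ℕtoℚ-mono-≤ n≤m))

-- Exponent bounds in terms of natural numbers.

-- As `p ≤ N`, the product `r * p` is at most `p + p/N`, hence at most `p + 1`: one repeated letter
-- already gives exponent `r`.
1+1/N-power : ∀ {N p r} → 1 ≤ p → p ≤ N → r < 1ℚ + recip N →
              r Q.* ℕtoℚ p Q.≤ ℕtoℚ (suc p)
1+1/N-power {0} (ℕ.s≤s _) ()
1+1/N-power {N@(suc n)} {p} {r} _ p≤N r< = begin
  r Q.* ℕtoℚ p                          ≤⟨ ℚ.*-monoʳ-≤-nonNeg (ℕtoℚ p) ⦃ ℕtoℚ-nonNegative p ⦄ (ℚ.<⇒≤ r<) ⟩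
  (1ℚ + recip N) Q.* ℕtoℚ p             ≡⟨ ℚ.*-distribʳ-+ (ℕtoℚ p) 1ℚ (recip N) ⟩
  1ℚ Q.* ℕtoℚ p + recip N Q.* ℕtoℚ p    ≡⟨ cong (_+ recip N Q.* ℕtoℚ p) (ℚ.*-identityˡ (ℕtoℚ p)) ⟩
  ℕtoℚ p + recip N Q.* ℕtoℚ p           ≤⟨ ℚ.+-monoʳ-≤ (ℕtoℚ p)
    (ℚ.*-monoˡ-≤-nonNeg (recip N) ⦃ ℚ.normalize-nonNeg 1 N ⦄ (ℕtoℚ-mono-≤ p≤N)) ⟩
  ℕtoℚ p + recip N Q.* ℕtoℚ N           ≡⟨ cong (ℕtoℚ p +_) (recip-inverse n) ⟩
  ℕtoℚ p + ℕtoℚ 1                       ≡⟨ ℕtoℚ-+ p 1 ⟨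
  ℕtoℚ (p ℕ.+ 1)                        ≡⟨ cong ℕtoℚ (ℕ.+-comm p 1) ⟩
  ℕtoℚ (suc p)                          ∎
  where open ℚ.≤-Reasoning

-- Multiplying `(1 + C/N) * p < n` by `N` clears the denominator, so the rest of the upper bound is
-- natural-number arithmetic.
1+C/N-power : ∀ {N C p n r} → 1 ≤ N → 1 ≤ p → 1ℚ + ℕtoℚ C Q.* recip N < r →
              r Q.* ℕtoℚ p Q.≤ ℕtoℚ n → N * p ℕ.+ C * p ℕ.< N * n
1+C/N-power {N@(suc N′)} {C} {p@(suc p′)} {n} {r} _ _ <r rp≤n = ℕtoℚ-cancel-< (begin-strict
  ℕtoℚ (N * p ℕ.+ C * p)
    ≡⟨ trans (ℕtoℚ-+ (N * p) (C * p)) (cong₂ _+_ (ℕtoℚ-* N p) (ℕtoℚ-* C p)) ⟩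
  ℕtoℚ N Q.* ℕtoℚ p + ℕtoℚ C Q.* ℕtoℚ p
    -- A factor `recip N * N` equal to 1 is inserted, so that the solver can treat the reciprocal as
    -- an independent variable.
    ≡⟨ cong (λ x → ℕtoℚ N Q.* ℕtoℚ p + x) (sym (trans
         (cong (Q._* (ℕtoℚ C Q.* ℕtoℚ p)) (recip-inverse N′)) (ℚ.*-identityˡ _))) ⟩
  ℕtoℚ N Q.* ℕtoℚ p + (recip N Q.* ℕtoℚ N) Q.* (ℕtoℚ C Q.* ℕtoℚ p)
    ≡⟨ solve 4 (λ N p C ρ → N :* p :+ (ρ :* N) :* (C :* p) := N :* ((con 1ℚ :+ C :* ρ) :* p))
         refl (ℕtoℚ N) (ℕtoℚ p) (ℕtoℚ C) (recip N) ⟩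
  ℕtoℚ N Q.* ((1ℚ + ℕtoℚ C Q.* recip N) Q.* ℕtoℚ p)
    <⟨ ℚ.*-monoʳ-<-pos (ℕtoℚ N) ⦃ ℕtoℚ-positive N′ ⦄
         (ℚ.*-monoˡ-<-pos (ℕtoℚ p) ⦃ ℕtoℚ-positive p′ ⦄ <r) ⟩
  ℕtoℚ N Q.* (r Q.* ℕtoℚ p)
    ≤⟨ ℚ.*-monoˡ-≤-nonNeg (ℕtoℚ N) ⦃ ℕtoℚ-nonNegative N ⦄ rp≤n ⟩
  ℕtoℚ N Q.* ℕtoℚ n
    ≡⟨ ℕtoℚ-* N n ⟨
  ℕtoℚ (N * n) ∎)
  where
  open ℚ.≤-Reasoning
  open +-*-Solver

1≤1+C/N : ∀ {N} C → 1 ≤ N → 1ℚ Q.≤ 1ℚ + ℕtoℚ C Q.* recip N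
1≤1+C/N {N@(suc N′)} C _ = ℚ.+-monoʳ-≤ 1ℚ {x = Q.0ℚ} {y = ℕtoℚ C Q.* recip N}
  (ℚ.nonNegative⁻¹ (ℕtoℚ C Q.* recip N)
     ⦃ ℚ.nonNeg*nonNeg⇒nonNeg (ℕtoℚ C) ⦃ ℕtoℚ-nonNegative C ⦄
       (recip N) ⦃ ℚ.normalize-nonNeg 1 N ⦄ ⦄)

-- The two bounds.

unavoidable : ∀ a l → 1 ≤ l → (r : ℚ) → 1ℚ < r → r < 1ℚ + recip (a * l) → ¬ Avoidable a l r
unavoidable a l 1≤l r _ r< (_ , w , avoids) with Words.repeated-letter {l = l} w
... | i , p , l≤p , p≤al , wᵢ≡wᵢ₊ₚ =
  -- The factor has length `suc p`, so its period condition concerns only `j = 0`.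
  avoids (i , p , suc p , l≤p , 1≤p , 1+1/N-power 1≤p p≤al r< , agree)
  where
  1≤p = ℕ.≤-trans 1≤l l≤p
  agree : ∀ j → j ℕ.+ p ℕ.< suc p → w (i ℕ.+ j) ≡ w (i ℕ.+ j ℕ.+ p)
  agree 0       _         rewrite ℕ.+-identityʳ i = wᵢ≡wᵢ₊ₚ
  agree (suc j) (ℕ.s≤s j+p<p) with () ← ℕ.<⇒≱ j+p<p (ℕ.m≤n+m p j)

-- A forbidden power of length `n` would have excess `q = n - p` with `C * p < N * q`, whereas
-- `repetition-short` bounds `N * q` by `384 * 512 * p`.
avoidable : ∀ {C} a l → 384 * 512 ≤ C → 2 ≤ a → 1 ≤ l → (r : ℚ) →
            1ℚ + ℕtoℚ C Q.* recip (a * l) < r → Avoidable a l r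
avoidable {C} a l c≤C 2≤a 1≤l r <r = ℚ.≤-<-trans (1≤1+C/N C 1≤al) <r , word , avoids
  where
  1≤al : 1 ≤ a * l
  1≤al = ℕ.*-mono-≤ (ℕ.<⇒≤ 2≤a) 1≤l
  open Words.Word a l ⦃ ℕ.>-nonZero 1≤l ⦄ 2≤a
  avoids : ¬ ContainsPower word l r
  avoids (i , p , n , l≤p , 1≤p , rp≤n , period) = ℕ.<⇒≱ Cp<Nq
    (ℕ.≤-trans (repetition-short l≤p 1≤p (ℕ.m<n⇒0<n∸m p<n) agrees)
      (ℕ.≤-trans (ℕ.≤-reflexive (sym (ℕ.*-assoc 384 512 p))) (ℕ.*-monoˡ-≤ p c≤C)))
    where
    open ℕ.≤-Reasoning
    N = a * l
    excess : N * p ℕ.+ C * p ℕ.< N * n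
    excess = 1+C/N-power {C = C} 1≤al 1≤p <r rp≤n
    p<n : p ℕ.< n
    p<n = ℕ.*-cancelˡ-< N p n (ℕ.≤-<-trans (ℕ.m≤m+n (N * p) (C * p)) excess)
    Cp<Nq : C * p ℕ.< N * (n ℕ.∸ p)
    Cp<Nq = ℕ.+-cancelˡ-< (N * p) _ _ (begin-strict
      N * p ℕ.+ C * p              <⟨ excess ⟩
      N * n                        ≡⟨ cong (N *_) (ℕ.m+[n∸m]≡n (ℕ.<⇒≤ p<n)) ⟨
      N * (p ℕ.+ (n ℕ.∸ p))        ≡⟨ ℕ.*-distribˡ-+ N p (n ℕ.∸ p) ⟩
      N * p ℕ.+ N * (n ℕ.∸ p)      ∎)
    agrees : Words.Agrees word i p (n ℕ.∸ p)
    agrees m i≤m m< with ℕ.m≤n⇒∃[o]m+o≡n i≤m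
    ... | j , refl = period j (begin-strict
      j ℕ.+ p            <⟨ ℕ.+-monoˡ-< p (ℕ.+-cancelˡ-< i j _ m<) ⟩
      n ℕ.∸ p ℕ.+ p      ≡⟨ ℕ.m∸n+n≡m (ℕ.<⇒≤ p<n) ⟩
      n                  ∎)

-- The infimum is expressed by its two sides: nothing below the lower bound is avoidable, everything
-- above the upper bound is. Avoidability passes to larger `r`, so testing rational `r` is enough.
theorem5 : Σ ℚ λ c → (a l : ℕ) → 2 ≤ a → 1 ≤ l →
    ((r : ℚ) → 1ℚ < r → r < 1ℚ + recip (a * l) → ¬ Avoidable a l r)
    × ((r : ℚ) → 1ℚ + c Q.* recip (a * l) < r → Avoidable a l r)
-- The factor 384 compares `a * l` with `M`, and 512 is the window length at which the descent
-- stops.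
theorem5 = ℕtoℚ (384 * 512) , λ a l 2≤a 1≤l →
  unavoidable a l 1≤l , avoidable a l ℕ.≤-refl 2≤a 1≤l
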